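{- Let $S$ be a recurrent specular set on the finite alphabet $A$, let $X\subset S$ be its even code, and let $f:B^*\to A^*$ be a coding morphism for $X$, i.e. a morphism mapping the alphabet $B$ bijectively onto $X$. Then the decoding $f^{ -1}(S)$ is a union of two recurrent tree sets of characteristic $1$; more precisely, $f^{ -1}(S_{0,0})$ and $f^{ -1}(S_{1,1})$ are recurrent tree sets of characteristic $1$ (on the alphabets $f^{ -1}(X\cap S_{0,0})$ and $f^{ -1}(X\cap S_{1,1})$ respectively), and $f^{ -1}(S)$ is their union.
   Context: Words are over finite alphabets; $\varepsilon$ is the empty word. A set $S$ of words on $A$ is factorial if it contains $A$ and all the factors of its elements. For $w\in S$ let $L(w)=\{a\in A\mid aw\in S\}$, $R(w)=\{a\in A\mid wa\in S\}$, $B(w)=\{(a,b)\in A\times A\mid awb\in S\}$. A factorial set $S$ is biextendable if $B(w)\neq\emptyset$ for all $w\in S$. The extension graph $\mathcal{E}(w)$ is the undirected graph whose vertex set is the disjoint union of $L(w)$ and $R(w)$ and whose edges are the pairs in $B(w)$; the copy of $a\in L(w)$ is denoted $1\otimes a$ and the copy of $b\in R(w)$ is denoted $b\otimes1$. A biextendable set $S$ is a tree set of characteristic $c$ if $\mathcal{E}(w)$ is a tree for every nonempty $w\in S$ and $\mathcal{E}(\varepsilon)$ is a disjoint union of $c$ trees. Let $\theta$ be an involution on $A$ (possibly with fixed points) and let $G_\theta$ be the group generated by $A$ with relations $a\theta(a)=1$, $a\in A$ (so $a^{ -1}=\theta(a)$). A word is reduced if it has no factor $a\theta(a)$ with $a\in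 A$; the inverse of a reduced word $a_1\cdots a_n$ is the reduced word $\theta(a_n)\cdots\theta(a_1)$. A laminary set on $A$ relative to $\theta$ is a biextendable set of reduced words closed under taking inverses. A specular set is a laminary set which is a tree set of characteristic $2$. A set $S\ne\{\varepsilon\}$ is recurrent if it is factorial and for all $u,w\in S$ there is $v\in S$ with $uvw\in S$. Let $S$ be specular and let $\mathcal{T}_0,\mathcal{T}_1$ be the two trees forming $\mathcal{E}(\varepsilon)$. A letter $a$ is even if its two occurrences $1\otimes a$ and $a\otimes 1$ are in the same tree, and odd otherwise. A word of $S$ is even if it has an even number of (occurrences of) odd letters. The even code is the set of nonempty even words of $S$ having no proper nonempty even prefix; it is a bifix code. The parity graph of $S$ is the directed graph with vertices $0,1$ having, for each letter $a\in A$, exactly one edge labeled $a$, going from $i$ to $j$ where $a\otimes 1$ is a vertex of $\mathcal{T}_i$ and $1\otimes a$ is a vertex of $\mathcal{T}_j$. $S_{i,j}$ is the set of words of $S$ which are labels of a path from $i$ to $j$ in the parity graph (with $\varepsilon\in S_{0,0}\cap S_{1,1}$). -}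

module Defs where

open import Algebra.Definitions using (Involutive)
open import Algebra.Morphism.Structures using (IsMonoidHomomorphism)
open import Data.Empty using (⊥)
open import Data.Fin using (Fin)
import Data.Fin.Properties as Fin
open import Data.List using (List; []; _∷_; _++_; [_]; map; reverse; length; filter; ++-[]-rawMonoid)
open import Data.List.Properties using (++-identityʳ)
open import Data.List.Relation.Unary.All using (All)
open import Data.List.Relation.Unary.Unique.Propositional using (Unique)
open import Data.Nat using (ℕ; _≤_)
open import Data.Nat.Divisibility using (_∣_)
open import Data.Product using (∃; ∃-syntax; _×_; _,_)
open import Data.Sum using (_⊎_; inj₁; inj₂)
open import Function.Bundles using (_⇔_; Equivalence)
open import Level using (0ℓ)
open import Relation.Binary.Core using (Rel)
open import Relation.Binary.Construct.Closure.ReflexiveTransitive using (Star; ε; _◅_)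
open import Relation.Binary.Definitions using (Symmetric; Irreflexive)
open import Relation.Binary.PropositionalEquality using (_≡_; _≢_; refl; sym; trans; subst; cong)
open import Relation.Nullary using (¬_; yes; no; ¬?)
open import Relation.Unary using (Pred; Decidable; U; _≐_; ｛_｝)

-- Undirected simple graphs whose vertices form a subset of a type V.
record Graph (V : Set) : Set₁ where
  field
    Vertex     : Pred V 0ℓ
    Adj        : Rel V 0ℓ
    adj-sym    : Symmetric Adj
    adj-irrefl : Irreflexive _≡_ Adj
    adj-vertex : ∀ {x y} → Adj x y → Vertex x

open Graph public

module _ {V : Set} where

  vertices : (G : Graph V) → ∀ {x y} → Star (Adj G) x y → List V
  vertices G {x} ε       = [ x ]
  vertices G {x} (_ ◅ p) = x ∷ vertices G p

  Connected : Graph V → Set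
  Connected G = ∀ {x y} → Vertex G x → Vertex G y → Star (Adj G) x y

  -- A cycle is a walk through at least three pairwise distinct vertices,
  -- together with an edge from its last vertex back to its first.
  Acyclic : Graph V → Set
  Acyclic G = ∀ {x y} (p : Star (Adj G) x y) →
    Unique (vertices G p) → 3 ≤ length (vertices G p) → ¬ Adj G y x

  record IsTree (G : Graph V) : Set where
    field
      nonempty  : ∃ (Vertex G)
      connected : Connected G
      acyclic   : Acyclic G

  record IsDisjointUnion {c : ℕ} (G : Graph V) (T : Fin c → Graph V) : Set where
    field
      vertex-⇔ : ∀ v → Vertex G v ⇔ (∃[ i ] Vertex (T i) v)
      adj-⇔    : ∀ x y → Adj G x y ⇔ (∃[ i ] Adj (T i) x y)
      disjoint : ∀ {i j v} → Vertex (T i) v → Vertex (T j) v → i ≡ j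

  record IsUnionOfTrees (c : ℕ) (G : Graph V) : Set₁ where
    field
      tree            : Fin c → Graph V
      isTree          : ∀ i → IsTree (tree i)
      isDisjointUnion : IsDisjointUnion G tree

-- The alphabet of a set of words is a subset P of a type A (P = U when the
-- alphabet is all of A).

Language : Set → Set₁
Language A = Pred (List A) 0ℓ

module _ {A : Set} where

  record IsFactorial (P : Pred A 0ℓ) (S : Language A) : Set where
    field
      over    : ∀ {w} → S w → All P w
      letters : ∀ {a} → P a → S [ a ]
      factors : ∀ u v w → S (u ++ v ++ w) → S v

  L : Language A → List A → Pred A 0ℓ
  L S w a = S (a ∷ w)

  R : Language A → List A → Pred A 0ℓ
  R S w b = S (w ++ [ b ])

  B : Language A → List A → A → A → Set
  B S w a b = S (a ∷ w ++ [ b ])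

  record IsBiextendable (P : Pred A 0ℓ) (S : Language A) : Set where
    field
      isFactorial : IsFactorial P S
      extend      : ∀ {w} → S w → ∃[ a ] ∃[ b ] B S w a b

  -- 1⊗ a is the copy of a ∈ L(w), and b ⊗1 is the copy of b ∈ R(w).
  pattern 1⊗_ a = inj₁ a
  pattern _⊗1 b = inj₂ b

  extVertex : Language A → List A → Pred (A ⊎ A) 0ℓ
  extVertex S w (1⊗ a) = L S w a
  extVertex S w (b ⊗1) = R S w b

  extAdj : Language A → List A → Rel (A ⊎ A) 0ℓ
  extAdj S w (1⊗ a) (b ⊗1) = B S w a b
  extAdj S w (b ⊗1) (1⊗ a) = B S w a b
  extAdj S w (1⊗ _) (1⊗ _) = ⊥
  extAdj S w (_ ⊗1) (_ ⊗1) = ⊥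

  extensionGraph : ∀ {P S} → IsFactorial P S → List A → Graph (A ⊎ A)
  extensionGraph {S = S} fac w = record
    { Vertex     = extVertex S w
    ; Adj        = extAdj S w
    ; adj-sym    = λ {x} {y} → symm x y
    ; adj-irrefl = λ {x} {y} → irr x y
    ; adj-vertex = λ {x} {y} → vert x y
    }
    where
    open IsFactorial fac

    symm : ∀ x y → extAdj S w x y → extAdj S w y x
    symm (1⊗ _) (_ ⊗1) e = e
    symm (_ ⊗1) (1⊗ _) e = e

    irr : ∀ x y → x ≡ y → ¬ extAdj S w x y
    irr (1⊗ _) _ refl ()
    irr (_ ⊗1) _ refl ()

    vert : ∀ x y → extAdj S w x y → extVertex S w x
    vert (1⊗ a) (b ⊗1) e = factors [] (a ∷ w) [ b ] e
    vert (b ⊗1) (1⊗ a) e = factors [ a ] (w ++ [ b ]) []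
      (subst S (cong (a ∷_) (sym (++-identityʳ (w ++ [ b ])))) e)

  record IsTreeSet (c : ℕ) (P : Pred A 0ℓ) (S : Language A) : Set₁ where
    field
      isBiextendable : IsBiextendable P S

    open IsBiextendable isBiextendable public

    field
      nonempty-tree : ∀ {w} → S w → w ≢ [] → IsTree (extensionGraph isFactorial w)
      empty-forest  : IsUnionOfTrees c (extensionGraph isFactorial [])

  record IsRecurrent (P : Pred A 0ℓ) (S : Language A) : Set where
    field
      nontrivial  : ¬ (S ≐ ｛ [] ｝)
      isFactorial : IsFactorial P S
      recur       : ∀ {u w} → S u → S w → ∃[ v ] (S v × S (u ++ v ++ w))

module _ {A : Set} (θ : A → A) where

  Reduced : Language A
  Reduced w = ∀ u a v → w ≢ u ++ a ∷ θ a ∷ v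

  inverse : List A → List A
  inverse w = reverse (map θ w)

  record IsLaminary (S : Language A) : Set where
    field
      involutive     : Involutive _≡_ θ
      isBiextendable : IsBiextendable U S
      reduced        : ∀ {w} → S w → Reduced w
      inverse-closed : ∀ {w} → S w → S (inverse w)

  record IsSpecular (S : Language A) : Set₁ where
    field
      isLaminary : IsLaminary S
      isTreeSet  : IsTreeSet 2 U S

-- The numbering of the two trees of the extension graph of the empty word
-- is the one carried by the specularity witness.
module Parity {A : Set} {θ : A → A} {S : Language A} (sp : IsSpecular θ S) where

  open IsTreeSet (IsSpecular.isTreeSet sp) using (isFactorial; empty-forest)
  open IsUnionOfTrees empty-forest
  open IsDisjointUnion isDisjointUnion

  𝒯 : Fin 2 → Graph (A ⊎ A)
  𝒯 = tree

  EvenLetter : Pred A 0ℓ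
  EvenLetter a = ∃[ i ] (Vertex (𝒯 i) (1⊗ a) × Vertex (𝒯 i) (a ⊗1))

  OddLetter : Pred A 0ℓ
  OddLetter a = ¬ EvenLetter a

  evenLetter? : Decidable EvenLetter
  evenLetter? a
    with Equivalence.to (vertex-⇔ (1⊗ a)) (IsFactorial.letters isFactorial _)
       | Equivalence.to (vertex-⇔ (a ⊗1)) (IsFactorial.letters isFactorial _)
  ... | i , p | j , q with i Fin.≟ j
  ...   | yes refl = yes (i , p , q)
  ...   | no i≢j   = no λ (_ , p′ , q′) → i≢j (trans (disjoint p p′) (disjoint q′ q))

  oddLetter? : Decidable OddLetter
  oddLetter? a = ¬? (evenLetter? a)

  EvenWord : Language A
  EvenWord w = S w × 2 ∣ length (filter oddLetter? w)

  record EvenCode (w : List A) : Set where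
    field
      even     : EvenWord w
      nonempty : w ≢ []
      minimal  : ∀ u v → w ≡ u ++ v → u ≢ [] → v ≢ [] → ¬ EvenWord u

  ParityEdge : Fin 2 → A → Fin 2 → Set
  ParityEdge i a j = Vertex (𝒯 i) (a ⊗1) × Vertex (𝒯 j) (1⊗ a)

  data ParityPath : Fin 2 → List A → Fin 2 → Set where
    []  : ∀ {i} → ParityPath i [] i
    _∷_ : ∀ {i j k a w} → ParityEdge i a j → ParityPath j w k → ParityPath i (a ∷ w) k

  S[_,_] : Fin 2 → Fin 2 → Language A
  S[ i , j ] w = S w × ParityPath i w j

record IsCodingMorphism {A B : Set} (X : Language A) (f : List B → List A) : Set where
  field
    isMorphism : IsMonoidHomomorphism (++-[]-rawMonoid B) (++-[]-rawMonoid A) f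
    into       : ∀ b → X (f [ b ])
    injective  : ∀ {b c} → f [ b ] ≡ f [ c ] → b ≡ c
    surjective : ∀ {x} → X x → ∃[ b ] f [ b ] ≡ x

{-# OPTIONS --safe #-}

-- For codes U and V and a word w, let 𝓔(U, V, w) be the graph whose vertices are
-- the u ∈ U with uw ∈ S and the v ∈ V with wv ∈ S, and whose edges are the pairs
-- with uwv ∈ S; for empty w, keep only the pairs that meet in a given tree 𝒯 i.
-- If U is a single empty word this is a star. If U is the union over the letters a
-- of the sets U_a a, it arises from 𝓔(A, V, w) by replacing each vertex a with the
-- graph 𝓔(U_a, V, aw), whose right vertices are exactly the neighbours of a; such
-- a replacement turns trees into trees. Together with the mirror image
-- of this step, induction on U and V reduces the claim to the extension graphs of S.
-- Now the extension graph of a word w of f⁻¹(S[ i , i ]) is 𝓔(X, X, f(w)), where X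
-- is the even code. That X is a code of the inductive kind above uses recurrence:
-- a word consisting of an odd letter and even letters extends to an element of X
-- and therefore has bounded length.
module Submission where

open import Defs
open import Algebra.Morphism.Structures using (IsMonoidHomomorphism)
open import Data.Bool using (if_then_else_)
open import Data.Empty using (⊥; ⊥-elim)
open import Data.Fin using (Fin; zero; suc)
open import Data.Fin.Properties using (inj⇒≟)
open import Data.List using (List; []; _∷_; _++_; [_]; _ʳ++_; reverse; length; filter; initLast; _∷ʳ′_)
open import Data.List.Membership.Propositional using (_∈_)
open import Data.List.Properties using (++-assoc; ++-conicalˡ; ++-conicalʳ; ++-identityʳ; filter-accept; filter-reject; length-++; length-reverse; reverse-++; reverse-injective; reverse-involutive; unfold-reverse; ʳ++-defn)
open import Data.List.Relation.Unary.All as All using (All; []; _∷_)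
open import Data.List.Relation.Unary.All.Properties using (++⁺; ¬Any⇒All¬)
open import Data.List.Relation.Unary.AllPairs using ([]; _∷_)
open import Data.List.Relation.Unary.Any using (here; there)
open import Data.List.Relation.Unary.Unique.Propositional using (Unique)
open import Data.Nat using (ℕ; zero; suc; _≤_; _⊔_; z≤n; s≤s)
open import Data.Nat.Divisibility using (_∣_; ∣⇒≤; _∣0; ∣-refl)
open import Data.Nat.Properties using (<⇒≱; m≤m+n; m≤m⊔n; m≤n⇒m≤1+n; m≤n⊔m; ≤-reflexive; ≤-trans)
open import Data.Product using (∃; ∃-syntax; _×_; _,_; proj₁; proj₂; map₂)
open import Data.Sum using (_⊎_; inj₁; inj₂; swap)
open import Data.Sum.Properties using (inj₁-injective; inj₂-injective; swap-involutive) renaming (≡-dec to ⊎-≡-dec)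
open import Data.Unit using (⊤; tt)
open import Function using (_∘_; id)
open import Function.Bundles using (Equivalence; Inverse; _↔_; mk⇔)
open import Function.Properties.Inverse using (↔⇒↣)
open import Level using (0ℓ)
open import Relation.Binary.Construct.Closure.ReflexiveTransitive using (Star; ε; _◅_; _◅◅_; gmap)
open import Relation.Binary.Core using (Rel)
open import Relation.Binary.Definitions using (DecidableEquality)
open import Relation.Binary.PropositionalEquality using (_≡_; _≢_; refl; sym; trans; cong; subst; subst₂)
open import Relation.Nullary using (¬_; does; yes; no; ¬?; contradiction)
open import Relation.Unary using (Pred; Decidable; U; _≐_; _∪_; _∩_; _⊢_)

-- Trees

module _ {V : Set} where

  _avoiding_ : Rel V 0ℓ → V → Rel V 0ℓ
  (E avoiding p) s t = E s t × t ≢ p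

  NoDetour : Rel V 0ℓ → Set
  NoDetour E = ∀ {p s t} → E p s → E p t → Star (E avoiding p) s t → s ≡ t

  suffixPath : (G : Graph V) {P : Pred V 0ℓ} → ∀ {s t x} (q : Star (Adj G) s t) →
    Unique (vertices G q) → All P (vertices G q) → x ∈ vertices G q →
    ∃[ q′ ] (Unique (vertices G {x} {t} q′) × All P (vertices G q′))
  suffixPath G ε       u        a        (here refl) = ε , u , a
  suffixPath G (e ◅ q) u        a        (here refl) = e ◅ q , u , a
  suffixPath G (e ◅ q) (_ ∷ u)  (_ ∷ a)  (there m)   = suffixPath G q u a m

  module _ (_≟_ : DecidableEquality V) where

    open import Data.List.Membership.DecPropositional _≟_ using (_∈?_)

    -- Loop erasure: if `s` recurs on the simple path already found for the rest of the walk, only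
    -- the part of that path from `s` onwards is kept.
    simplePath : (G : Graph V) → ∀ {p s t} → p ≢ s → Star (Adj G avoiding p) s t →
      ∃[ q ] (Unique (vertices G {s} {t} q) × All (p ≢_) (vertices G q))
    simplePath G p≢s ε = ε , [] ∷ [] , p≢s ∷ []
    simplePath G {s = s} p≢s ((e , t≢p) ◅ w) with simplePath G (t≢p ∘ sym) w
    ... | q , u , a with s ∈? vertices G q
    ...   | yes s∈q = suffixPath G q u a s∈q
    ...   | no s∉q  = e ◅ q , ¬Any⇒All¬ _ s∉q ∷ u , p≢s ∷ a

    -- If `s` and `t` differ, a simple path between them that misses `p` closes up through `p` to a
    -- cycle.
    acyclic⇒noDetour : (G : Graph V) → Acyclic G → NoDetour (Adj G)
    acyclic⇒noDetour G acyclic {p} {s} {t} ps pt w with s ≟ t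
    ... | yes s≡t = s≡t
    ... | no s≢t with simplePath G (λ p≡s → adj-irrefl G p≡s ps) w
    ...   | ε , _ = contradiction refl s≢t
    ...   | e ◅ q , u , a =
      ⊥-elim (acyclic (ps ◅ e ◅ q) (a ∷ u) (s≤s (s≤s (nonempty q))) (adj-sym G pt))
      where
      nonempty : ∀ {x y} (q : Star (Adj G) x y) → 1 ≤ length (vertices G q)
      nonempty ε       = s≤s z≤n
      nonempty (_ ◅ _) = s≤s z≤n

  avoidingPath : (G : Graph V) → ∀ {p s t} (q : Star (Adj G) s t) →
    All (p ≢_) (vertices G q) → Star (Adj G avoiding p) s t
  avoidingPath G ε             _             = ε
  avoidingPath G (e ◅ ε)       (_ ∷ p≢t ∷ _) = (e , p≢t ∘ sym) ◅ ε
  avoidingPath G (e ◅ e′ ◅ q)  (_ ∷ p≢t ∷ a) = (e , p≢t ∘ sym) ◅ avoidingPath G (e′ ◅ q) (p≢t ∷ a)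

  end∈vertices : (G : Graph V) → ∀ {s t} (q : Star (Adj G) s t) → t ∈ vertices G q
  end∈vertices G ε       = here refl
  end∈vertices G (_ ◅ q) = there (end∈vertices G q)

  -- The second and the last vertex of a cycle are neighbours of the first, and the rest of the
  -- cycle joins them without visiting it; so they would coincide.
  noDetour⇒acyclic : (G : Graph V) → NoDetour (Adj G) → Acyclic G
  noDetour⇒acyclic G noDetour ε           _             (s≤s ())
  noDetour⇒acyclic G noDetour (_ ◅ ε)     _             (s≤s (s≤s ()))
  noDetour⇒acyclic G noDetour (e ◅ e′ ◅ q) (x∉ ∷ s∉ ∷ _) _ yx =
    All.lookup s∉ (end∈vertices G q) (noDetour e (adj-sym G yx) (avoidingPath G (e′ ◅ q) x∉))

-- Bipartite graphs and the replacement of vertices by trees.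

record Bipartite (X Y : Set) : Set₁ where
  field
    Left       : Pred X 0ℓ
    Right      : Pred Y 0ℓ
    Edge       : X → Y → Set
    edge-left  : ∀ {x y} → Edge x y → Left x
    edge-right : ∀ {x y} → Edge x y → Right y

open Bipartite

module _ {X Y : Set} where

  Node : Bipartite X Y → Pred (X ⊎ Y) 0ℓ
  Node G (inj₁ x) = Left G x
  Node G (inj₂ y) = Right G y

  Link : Bipartite X Y → Rel (X ⊎ Y) 0ℓ
  Link G (inj₁ x) (inj₂ y) = Edge G x y
  Link G (inj₂ y) (inj₁ x) = Edge G x y
  Link G (inj₁ _) (inj₁ _) = ⊥
  Link G (inj₂ _) (inj₂ _) = ⊥

  -- A graph is a forest iff no two distinct neighbours of a vertex p are
  -- joined by a walk avoiding p; unlike the absence of simple cycles, this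
  -- is directly compatible with lifting and projecting walks.
  record Arboreal (G : Bipartite X Y) : Set where
    field
      connected : ∀ {s t} → Node G s → Node G t → Star (Link G) s t
      noDetour  : NoDetour (Link G)

  link-node : (G : Bipartite X Y) → ∀ s t → Link G s t → Node G t
  link-node G (inj₁ _) (inj₂ _) = edge-right G
  link-node G (inj₂ _) (inj₁ _) = edge-left G

  flip : Bipartite X Y → Bipartite Y X
  flip G = record
    { Left = Right G ; Right = Left G ; Edge = λ y x → Edge G x y
    ; edge-left = edge-right G ; edge-right = edge-left G }

  -- Base case of both inductions: a code `stop` contributes only the empty word, joined to
  -- everything on the other side.
  star-arboreal : (G : Bipartite X Y) (c : X) → (∀ {x} → Left G x → x ≡ c) →
    (∀ {y} → Right G y → Edge G c y) → Arboreal G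
  star-arboreal G c center spoke = record { connected = λ {s} {t} → conn s t ; noDetour = λ {p} {s} {t} → nodet p s t }
    where
    conn : ∀ s t → Node G s → Node G t → Star (Link G) s t
    conn (inj₁ x) (inj₁ x′) l l′ with center l | center l′
    ... | refl | refl = ε
    conn (inj₁ x) (inj₂ y) l r with center l
    ... | refl = spoke r ◅ ε
    conn (inj₂ y) (inj₁ x) r l with center l
    ... | refl = spoke r ◅ ε
    conn (inj₂ y) (inj₂ y′) r r′ = _◅_ {j = inj₁ c} (spoke r) (spoke r′ ◅ ε)

    nodet : ∀ p s t → Link G p s → Link G p t → Star (Link G avoiding p) s t → s ≡ t
    nodet (inj₂ y) (inj₁ x) (inj₁ x′) e e′ _ =
      cong inj₁ (trans (center (edge-left G e)) (sym (center (edge-left G e′))))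
    nodet (inj₁ x) (inj₂ y) (inj₂ y) e e′ ε = refl
    nodet (inj₁ x) (inj₂ y) (inj₂ y′) e e′ (_◅_ {j = inj₁ x″} (f , x″≢x) w) =
      contradiction (cong inj₁ (trans (center (edge-left G f)) (sym (center (edge-left G e))))) x″≢x

-- Lets the replacement of left vertices by trees be applied to right vertices as well.
flip-arboreal : ∀ {X Y} {G : Bipartite X Y} → Arboreal (flip G) → Arboreal G
flip-arboreal {X} {Y} {G} tree = record { connected = λ {s} {t} → conn s t ; noDetour = λ {p} {s} {t} → nodet p s t }
  where
  open Arboreal tree

  link : ∀ s t → Link G s t → Link (flip G) (swap s) (swap t)
  link (inj₁ _) (inj₂ _) e = e
  link (inj₂ _) (inj₁ _) e = e

  unlink : ∀ s t → Link (flip G) s t → Link G (swap s) (swap t)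
  unlink (inj₁ _) (inj₂ _) e = e
  unlink (inj₂ _) (inj₁ _) e = e

  node : ∀ s → Node G s → Node (flip G) (swap s)
  node (inj₁ _) n = n
  node (inj₂ _) n = n

  unswap : ∀ {s t : X ⊎ Y} → swap s ≡ swap t → s ≡ t
  unswap {s} {t} eq = trans (sym (swap-involutive s)) (trans (cong swap eq) (swap-involutive t))

  conn : ∀ s t → Node G s → Node G t → Star (Link G) s t
  conn s t m n = subst₂ (Star (Link G)) (swap-involutive s) (swap-involutive t)
    (gmap swap (λ {x} {y} → unlink x y) (connected (node s m) (node t n)))

  nodet : ∀ p s t → Link G p s → Link G p t → Star (Link G avoiding p) s t → s ≡ t
  nodet p s t e e′ w = unswap (noDetour (link p s e) (link p t e′)
    (gmap swap (λ {x} {y} (f , y≢p) → link x y f , y≢p ∘ unswap) w))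

-- If every left vertex a of a tree G is replaced by a tree H a whose right
-- vertices are the neighbours of a in G, the resulting graph K is a tree.
module Expansion {A Y : Set} (_≟_ : DecidableEquality A)
  (G : Bipartite A Y) (H : A → Bipartite (List A) Y) (K : Bipartite (List A) Y)
  (left-[]  : ¬ Left K [])
  (left-∷   : ∀ {a l} → Left K (a ∷ l) → Left G a × Left (H a) l)
  (right-K  : ∀ {y} → Right K y → Right G y)
  (edge-KG  : ∀ {a l y} → Edge K (a ∷ l) y → Edge G a y)
  (edge-KH  : ∀ {a l y} → Edge K (a ∷ l) y → Edge (H a) l y)
  (edge-HK  : ∀ {a l y} → Left G a → Edge (H a) l y → Edge K (a ∷ l) y)
  (right-H  : ∀ {a y} → Edge G a y → Right (H a) y)
  (G-tree   : Arboreal G) (H-tree : ∀ {a} → Left G a → Arboreal (H a)) where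

  private
    module G = Arboreal G-tree

  ι : A → List A ⊎ Y → List A ⊎ Y
  ι a (inj₁ l) = inj₁ (a ∷ l)
  ι a (inj₂ y) = inj₂ y

  ι-path : ∀ {a} → Left G a → ∀ {s t} → Node (H a) s → Node (H a) t → Star (Link K) (ι a s) (ι a t)
  ι-path {a} l m n = gmap (ι a) (λ {s} {t} → link s t) (Arboreal.connected (H-tree l) m n)
    where
    link : ∀ s t → Link (H a) s t → Link K (ι a s) (ι a t)
    link (inj₁ _) (inj₂ _) = edge-HK l
    link (inj₂ _) (inj₁ _) = edge-HK l

  data Over : A ⊎ Y → List A ⊎ Y → Set where
    left  : ∀ {a l} → Left K (a ∷ l) → Over (inj₁ a) (inj₁ (a ∷ l))
    right : ∀ {y} → Over (inj₂ y) (inj₂ y)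

  -- A passage through a left vertex `a` from one neighbour to another lifts to a walk inside the
  -- connected graph `H a`, which has both neighbours as right vertices.
  lift-path : ∀ {g h s t} → Star (Link G) g h → Over g s → Over h t → Star (Link K) s t
  lift-path ε (left {a} l) (left l′) =
    ι-path (proj₁ (left-∷ l)) {inj₁ _} {inj₁ _} (proj₂ (left-∷ l)) (proj₂ (left-∷ l′))
  lift-path ε right right = ε
  lift-path (_◅_ {j = inj₂ y} e w) (left l) t =
    ι-path (edge-left G e) {inj₁ _} {inj₂ _} (proj₂ (left-∷ l)) (right-H e) ◅◅ lift-path w right t
  lift-path (_◅_ {j = inj₁ a} e ε) right (left l) =
    ι-path (edge-left G e) {inj₂ _} {inj₁ _} (right-H e) (proj₂ (left-∷ l))
  lift-path (_◅_ {j = inj₁ a} e (_◅_ {j = inj₂ y} e′ w)) right t =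
    ι-path (edge-left G e) {inj₂ _} {inj₂ _} (right-H e) (right-H e′) ◅◅ lift-path w right t

  -- A walk of K that starts in H a and avoids a vertex v of H a can be pushed
  -- into H a: an excursion outside H a returns through the neighbour of a at
  -- which it left, since G has no detours.
  module _ {a : A} {v s : List A ⊎ Y} where

    -- `door` and `away` record the neighbour `y` of `a` where the pushed walk waits, and the walk
    -- of `G` made since then without meeting `a`; for `door` it may be empty.
    data Trace : List A ⊎ Y → Set where
      inside : ∀ {l} → Star (Link (H a) avoiding v) s (inj₁ l) → Trace (inj₁ (a ∷ l))
      door   : ∀ {y y′} → Star (Link (H a) avoiding v) s (inj₂ y) → Edge G a y →
               Star (Link G avoiding inj₁ a) (inj₂ y) (inj₂ y′) → Trace (inj₂ y′)
      away   : ∀ {y a′ l} → Star (Link (H a) avoiding v) s (inj₂ y) → Edge G a y →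
               Star (Link G avoiding inj₁ a) (inj₂ y) (inj₁ a′) → a′ ≢ a → Trace (inj₁ (a′ ∷ l))

    step : ∀ {z} z′ → Trace z → Link K z z′ → z′ ≢ ι a v → Trace z′
    step (inj₂ y) (inside w) e y≢v =
      door (w ◅◅ (edge-KH e , y≢v ∘ cong (ι a)) ◅ ε) (edge-KG e) ε
    step (inj₂ y) (away w d g _) e _ = door w d (g ◅◅ (edge-KG e , λ ()) ◅ ε)
    step (inj₁ []) (door _ _ _) e _ = ⊥-elim (left-[] (edge-left K e))
    step (inj₁ (a′ ∷ l)) (door w d g) e l≢v with a′ ≟ a
    ... | no a′≢a = away w d (g ◅◅ (edge-KG e , a′≢a ∘ inj₁-injective) ◅ ε) a′≢a
    ... | yes refl with G.noDetour {inj₁ a} {inj₂ _} {inj₂ _} d (edge-KG e) g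
    ...   | refl = inside (w ◅◅ (edge-KH e , l≢v ∘ cong (ι a)) ◅ ε)

    trace : ∀ {z z′} → Trace z → Star (Link K avoiding ι a v) z z′ → Trace z′
    trace t ε             = t
    trace t ((e , n) ◅ w) = trace (step _ t e n) w

    inside⁻¹ : ∀ {l} → Trace (inj₁ (a ∷ l)) → Star (Link (H a) avoiding v) s (inj₁ l)
    inside⁻¹ (inside w)       = w
    inside⁻¹ (away _ _ _ a≢a) = contradiction refl a≢a

    door⁻¹ : ∀ {y} → Edge G a y → Trace (inj₂ y) → Star (Link (H a) avoiding v) s (inj₂ y)
    door⁻¹ e (door w d g) with G.noDetour {inj₁ a} {inj₂ _} {inj₂ _} d e g
    ... | refl = w

  mutual
    -- Since `G` has no detour around `y`, this places two left neighbours of `y` joined by a walk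
    -- avoiding `y` in the same `H a`.
    project-left : ∀ {y a l a′ l′} → Star (Link K avoiding inj₂ y) (inj₁ (a ∷ l)) (inj₁ (a′ ∷ l′)) →
      Star (Link G avoiding inj₂ y) (inj₁ a) (inj₁ a′)
    project-left ε                             = ε
    project-left (_◅_ {j = inj₂ _} (e , n) w) = (edge-KG e , n ∘ inj₂-cong) ◅ project-right w
      where
      inj₂-cong : ∀ {y y′ : Y} → inj₂ {A = A} y ≡ inj₂ y′ → inj₂ {A = List A} y ≡ inj₂ y′
      inj₂-cong refl = refl

    project-right : ∀ {y z a′ l′} → Star (Link K avoiding inj₂ y) (inj₂ z) (inj₁ (a′ ∷ l′)) →
      Star (Link G avoiding inj₂ y) (inj₂ z) (inj₁ a′)
    project-right (_◅_ {j = inj₁ []} (e , _) _)      = ⊥-elim (left-[] (edge-left K e))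
    project-right (_◅_ {j = inj₁ (a ∷ l)} (e , _) w) = (edge-KG e , λ ()) ◅ project-left w

  arboreal : Arboreal K
  arboreal = record { connected = λ {s} {t} → conn s t ; noDetour = λ {p} {s} {t} → nodet p s t }
    where
    over : ∀ s → Node K s → ∃[ g ] (Node G g × Over g s)
    over (inj₁ [])      l = ⊥-elim (left-[] l)
    over (inj₁ (a ∷ _)) l = inj₁ a , proj₁ (left-∷ l) , left l
    over (inj₂ y)       r = inj₂ y , right-K r , right

    conn : ∀ s t → Node K s → Node K t → Star (Link K) s t
    conn s t m n with over s m | over t n
    ... | g , g-node , g-over | h , h-node , h-over =
      lift-path (G.connected g-node h-node) g-over h-over

    nodet : ∀ p s t → Link K p s → Link K p t → Star (Link K avoiding p) s t → s ≡ t
    nodet (inj₁ []) (inj₂ _) _ e _ _ = ⊥-elim (left-[] (edge-left K e))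
    nodet (inj₁ (a ∷ l)) (inj₂ y) (inj₂ y′) e e′ w =
      Arboreal.noDetour (H-tree (edge-left G (edge-KG e))) {inj₁ l} {inj₂ y} {inj₂ y′} (edge-KH e) (edge-KH e′)
        (door⁻¹ (edge-KG e′) (trace {v = inj₁ l} (door ε (edge-KG e) ε) w))
    nodet (inj₂ y) (inj₁ []) _ e _ _ = ⊥-elim (left-[] (edge-left K e))
    nodet (inj₂ y) (inj₁ (_ ∷ _)) (inj₁ []) _ e _ = ⊥-elim (left-[] (edge-left K e))
    nodet (inj₂ y) (inj₁ (a ∷ l)) (inj₁ (a′ ∷ l′)) e e′ w
      with G.noDetour {inj₂ y} {inj₁ a} {inj₁ a′} (edge-KG e) (edge-KG e′) (project-left w)
    ... | refl = cong (ι a)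
      (Arboreal.noDetour (H-tree (edge-left G (edge-KG e))) {inj₂ y} {inj₁ l} {inj₁ l′} (edge-KH e) (edge-KH e′)
        (inside⁻¹ (trace {v = inj₂ y} (inside ε) w)))

-- Word graphs

-- A prefix code as a well-founded tree: `split` reads one more letter, `stop` ends the word.
data Code (A : Set) : Set where
  stop  : Code A
  split : (A → Code A) → Code A

_∈ᶜ_ : ∀ {A} → List A → Code A → Set
u       ∈ᶜ stop    = u ≡ []
[]      ∈ᶜ split _ = ⊥
(a ∷ u) ∈ᶜ split c = u ∈ᶜ c a

module ParityGraph {A : Set} {θ : A → A} {S : Language A} (sp : IsSpecular θ S) where

  open Parity sp
  open IsTreeSet (IsSpecular.isTreeSet sp) public
    using (isFactorial; extend; nonempty-tree; empty-forest)
  open IsFactorial isFactorial public using (letters; factors)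
  open IsUnionOfTrees empty-forest public using (isTree; isDisjointUnion)
  open IsDisjointUnion isDisjointUnion public

  prefix-closed : ∀ u v → S (u ++ v) → S u
  prefix-closed u v = factors [] u v

  suffix-closed : ∀ u v → S (u ++ v) → S v
  suffix-closed u v = factors u v [] ∘ subst (S ∘ (u ++_)) (sym (++-identityʳ v))

  suffix-closedʳ : ∀ u v → S (u ʳ++ v) → S v
  suffix-closedʳ u v = suffix-closed (reverse u) v ∘ subst S (ʳ++-defn u)

  prefix-closedʳ : ∀ u v w → S (u ʳ++ v ++ w) → S (u ʳ++ v)
  prefix-closedʳ u v w = subst S (sym (ʳ++-defn u)) ∘ prefix-closed (reverse u ++ v) w ∘
    subst S (trans (ʳ++-defn u) (sym (++-assoc (reverse u) v w)))

  private
    source-vertex : ∀ a → ∃[ i ] Vertex (𝒯 i) (a ⊗1)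
    source-vertex a = Equivalence.to (vertex-⇔ (a ⊗1)) (letters _)

    target-vertex : ∀ a → ∃[ i ] Vertex (𝒯 i) (1⊗ a)
    target-vertex a = Equivalence.to (vertex-⇔ (1⊗ a)) (letters _)

  source target : A → Fin 2
  source a = proj₁ (source-vertex a)
  target a = proj₁ (target-vertex a)

  edge : ∀ a → ParityEdge (source a) a (target a)
  edge a = proj₂ (source-vertex a) , proj₂ (target-vertex a)

  source-unique : ∀ {i a} → Vertex (𝒯 i) (a ⊗1) → source a ≡ i
  source-unique = disjoint (proj₁ (edge _))

  target-unique : ∀ {i a} → Vertex (𝒯 i) (1⊗ a) → target a ≡ i
  target-unique = disjoint (proj₂ (edge _))

  link-in-tree : ∀ {a b} → S (a ∷ b ∷ []) → Adj (𝒯 (target a)) (1⊗ a) (b ⊗1)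
  link-in-tree {a} {b} ab with Equivalence.to (adj-⇔ (1⊗ a) (b ⊗1)) ab
  ... | i , e with target-unique (adj-vertex (𝒯 i) e)
  ...   | refl = e

  -- `1⊗ a` and `b ⊗1` are adjacent in the extension graph of the empty word, hence lie in one tree.
  -- This makes every word of `S` the label of a path.
  consecutive : ∀ {a b w} → S (a ∷ b ∷ w) → target a ≡ source b
  consecutive {a} {b} {w} abw =
    sym (source-unique (adj-vertex (𝒯 (target a)) (adj-sym (𝒯 (target a))
      (link-in-tree (prefix-closed (a ∷ b ∷ []) w abw)))))

  Starts : Fin 2 → Pred (List A) 0ℓ
  Starts i []      = ⊤
  Starts i (a ∷ _) = source a ≡ i

  -- The left context is a reversed word, so its last letter comes first.
  Ends : Fin 2 → Pred (List A) 0ℓ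
  Ends i []      = ⊤
  Ends i (a ∷ _) = target a ≡ i

  -- A path of the parity graph labelled by the word u ʳ++ x of S is in state i
  -- after reading the (reversed) word u.
  Splits : Fin 2 → List A → List A → Set
  Splits i u x = S (u ʳ++ x) × Ends i u × Starts i x

  starts-prefix : ∀ {i} u v → Starts i (u ++ v) → Starts i u
  starts-prefix []      _ _ = tt
  starts-prefix (_ ∷ _) _ s = s

  starts-after : ∀ {a} x → S (a ∷ x) → Starts (target a) x
  starts-after []      _  = tt
  starts-after (b ∷ x) ax = sym (consecutive ax)

  ends-before : ∀ {a} u x → S (u ʳ++ a ∷ x) → Ends (source a) u
  ends-before []      _ _  = tt
  ends-before (b ∷ u) x uax = consecutive (suffix-closedʳ u _ uax)

  splits-prefix : ∀ {i} u v w → Splits i u (v ++ w) → Splits i u v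
  splits-prefix u v w (s , e , t) = prefix-closedʳ u v w s , e , starts-prefix v w t

  splits-suffix : ∀ {i} u x → Splits i u x → Splits i [] x
  splits-suffix u x (s , _ , t) = suffix-closedʳ u x s , tt , t

  -- Moving the cut one letter to the left changes the state to `source a`; hence the state varies
  -- in the induction on the left code.
  shift : ∀ {i a} u x → Splits i (a ∷ u) x → Splits (source a) u (a ∷ x)
  shift u x (s , _) = s , ends-before u x s , refl

  unshift : ∀ {i a} u x → target a ≡ i → Splits (source a) u (a ∷ x) → Splits i (a ∷ u) x
  unshift u x refl (s , _) = s , refl , starts-after x (suffix-closedʳ u _ s)

  splits-last : ∀ {i a} u x → Splits i (a ∷ u) x → Splits i [ a ] x
  splits-last u x (s , e , t) = suffix-closedʳ u _ s , e , t

  -- For empty `w` this is the tree `𝒯 i`. For nonempty `w` it is the whole extension graph if `w`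
  -- is in `S` and its first letter has source `i`, and it is empty otherwise.
  letterGraph : Fin 2 → List A → Bipartite A A
  letterGraph i w = record
    { Left       = λ a → Splits i [ a ] w
    ; Right      = λ b → Splits i [] (w ++ [ b ])
    ; Edge       = λ a b → Splits i [ a ] (w ++ [ b ])
    ; edge-left  = λ {a} {b} → splits-prefix [ a ] w [ b ]
    ; edge-right = λ {a} → splits-suffix [ a ] _
    }

  semiLetterGraph : Fin 2 → Code A → List A → Bipartite A (List A)
  semiLetterGraph i V w = record
    { Left       = λ a → Splits i [ a ] w
    ; Right      = λ v → v ∈ᶜ V × Splits i [] (w ++ v)
    ; Edge       = λ a v → v ∈ᶜ V × Splits i [ a ] (w ++ v)
    ; edge-left  = λ {a} {v} (_ , s) → splits-prefix [ a ] w v s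
    ; edge-right = λ {a} (v∈V , s) → v∈V , splits-suffix [ a ] _ s
    }

  -- Left words are stored reversed, so that `split` on `U` strips the letter next to `w`.
  wordGraph : Fin 2 → Code A → Code A → List A → Bipartite (List A) (List A)
  wordGraph i U V w = record
    { Left       = λ u → u ∈ᶜ U × Splits i u w
    ; Right      = λ v → v ∈ᶜ V × Splits i [] (w ++ v)
    ; Edge       = λ u v → u ∈ᶜ U × v ∈ᶜ V × Splits i u (w ++ v)
    ; edge-left  = λ {u} {v} (u∈U , _ , s) → u∈U , splits-prefix u w v s
    ; edge-right = λ {u} (_ , v∈V , s) → v∈V , splits-suffix u _ s
    }

  module _ (_≟_ : DecidableEquality A) where

    -- `G` is closed under adjacency in `T`, so a path of `T` that starts in `G` stays there.
    restrict-tree : (T : Graph (A ⊎ A)) → IsTree T → (G : Bipartite A A) →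
      (∀ s → Node G s → Vertex T s) → (∀ s t → Link G s t → Adj T s t) →
      (∀ s t → Node G s → Adj T s t → Link G s t) → Arboreal G
    restrict-tree T tree G vertex adj link = record
      { connected = λ {s} {t} m n → path m (IsTree.connected tree (vertex s m) (vertex t n))
      ; noDetour  = λ {p} {s} {t} e e′ w →
          acyclic⇒noDetour (⊎-≡-dec _≟_ _≟_) T (IsTree.acyclic tree) (adj p s e) (adj p t e′)
            (gmap id (λ {x} {y} (f , n) → adj x y f , n) w)
      }
      where
      path : ∀ {s t} → Node G s → Star (Adj T) s t → Star (Link G) s t
      path m ε       = ε
      path {s} m (_◅_ {j = z} e w) = link s z m e ◅ path (link-node G s z (link s z m e)) w

    letterGraph-arboreal : ∀ i w → Arboreal (letterGraph i w)
    letterGraph-arboreal i [] = restrict-tree (𝒯 i) (isTree i) _ vertex adj (λ s t _ → link s t)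
      where
      vertex : ∀ s → Node (letterGraph i []) s → Vertex (𝒯 i) s
      vertex (inj₁ a) (_ , refl , _) = proj₂ (edge a)
      vertex (inj₂ b) (_ , _ , refl) = proj₁ (edge b)

      adj : ∀ s t → Link (letterGraph i []) s t → Adj (𝒯 i) s t
      adj (inj₁ a) (inj₂ b) (s , refl , _) = link-in-tree s
      adj (inj₂ b) (inj₁ a) (s , refl , _) = adj-sym (𝒯 i) (link-in-tree s)

      split-edge : ∀ {a b} → S (a ∷ b ∷ []) → Vertex (𝒯 i) (1⊗ a) → Vertex (𝒯 i) (b ⊗1) →
        Splits i [ a ] [ b ]
      split-edge s x y = s , target-unique x , source-unique y

      link : ∀ s t → Adj (𝒯 i) s t → Link (letterGraph i []) s t
      link s t e with Equivalence.from (adj-⇔ s t) (i , e) | adj-vertex (𝒯 i) e | adj-vertex (𝒯 i) (adj-sym (𝒯 i) e)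
      link (inj₁ a) (inj₂ b) _ | ab | x | y = split-edge ab x y
      link (inj₂ b) (inj₁ a) _ | ab | x | y = split-edge ab y x
    -- Any vertex witnesses that `c ∷ w` is in `S` and that `source c ≡ i`, which makes the graph a
    -- full extension graph. Without vertices there is nothing to show.
    letterGraph-arboreal i (c ∷ w) = record
      { connected = λ {s} m n → Arboreal.connected (arboreal (source≡i s m) (inner s m)) m n
      ; noDetour  = λ {p} {s} {t} e → Arboreal.noDetour (arboreal (source≡i s (link-node G p s e)) (inner s (link-node G p s e))) e
      }
      where
      G : Bipartite A A
      G = letterGraph i (c ∷ w)

      source≡i : ∀ s → Node G s → source c ≡ i
      source≡i (inj₁ _) (_ , _ , e) = e
      source≡i (inj₂ _) (_ , _ , e) = e

      inner : ∀ s → Node G s → S (c ∷ w)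
      inner (inj₁ a) (s , _) = suffix-closed [ a ] _ s
      inner (inj₂ b) (s , _) = prefix-closed _ [ b ] s

      arboreal : source c ≡ i → S (c ∷ w) → Arboreal G
      arboreal c≡i cw = restrict-tree _ (nonempty-tree cw λ ()) G vertex adj (λ s t _ → link s t)
        where
        vertex : ∀ s → Node G s → extVertex S (c ∷ w) s
        vertex (inj₁ a) (s , _) = s
        vertex (inj₂ b) (s , _) = s

        adj : ∀ s t → Link G s t → extAdj S (c ∷ w) s t
        adj (inj₁ a) (inj₂ b) (s , _) = s
        adj (inj₂ b) (inj₁ a) (s , _) = s

        link : ∀ s t → extAdj S (c ∷ w) s t → Link G s t
        link (inj₁ a) (inj₂ b) s = s , trans (consecutive s) c≡i , c≡i
        link (inj₂ b) (inj₁ a) s = s , trans (consecutive s) c≡i , c≡i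

    semiLetterGraph-arboreal : ∀ i V w → Arboreal (semiLetterGraph i V w)
    semiLetterGraph-arboreal i stop w = flip-arboreal
      (star-arboreal _ [] proj₁ (λ {a} s → refl , subst (Splits i [ a ]) (sym (++-identityʳ w)) s))
    semiLetterGraph-arboreal i (split c) w = flip-arboreal (Expansion.arboreal _≟_
      (flip (letterGraph i w)) (λ b → flip (semiLetterGraph i (c b) (w ++ [ b ])))
      (flip (semiLetterGraph i (split c) w))
      proj₁
      (λ {b} {v} (v∈c , s) → splits-prefix [] (w ++ [ b ]) v (subst (Splits i []) (assoc b v) s)
                           , v∈c , subst (Splits i []) (assoc b v) s)
      (λ s → s)
      (λ {b} {v} {a} (_ , s) → splits-prefix [ a ] (w ++ [ b ]) v (subst (Splits i [ a ]) (assoc b v) s))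
      (λ {b} {v} {a} (v∈c , s) → v∈c , subst (Splits i [ a ]) (assoc b v) s)
      (λ {b} {v} {a} _ (v∈c , s) → v∈c , subst (Splits i [ a ]) (sym (assoc b v)) s)
      (λ s → s)
      (flip-arboreal (letterGraph-arboreal i w))
      (λ {b} _ → flip-arboreal (semiLetterGraph-arboreal i (c b) (w ++ [ b ]))))
      where
      assoc : ∀ b v → w ++ b ∷ v ≡ (w ++ [ b ]) ++ v
      assoc b v = sym (++-assoc w [ b ] v)

    wordGraph-arboreal : ∀ i U V w → Arboreal (wordGraph i U V w)
    wordGraph-arboreal i stop V w = star-arboreal _ [] proj₁ (refl ,_)
    wordGraph-arboreal i (split c) V w = Expansion.arboreal _≟_
      (semiLetterGraph i V w) (λ a → wordGraph (source a) (c a) V (a ∷ w)) (wordGraph i (split c) V w)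
      proj₁
      (λ {a} {u} (u∈c , s) → splits-last u w s , u∈c , shift u w s)
      (λ r → r)
      (λ {a} {u} {v} (_ , v∈V , s) → v∈V , splits-last u (w ++ v) s)
      (λ {a} {u} {v} (u∈c , v∈V , s) → u∈c , v∈V , shift u (w ++ v) s)
      (λ {a} {u} {v} (_ , a≡i , _) (u∈c , v∈V , s) → u∈c , v∈V , unshift u (w ++ v) a≡i s)
      (λ {a} {v} (v∈V , s) → v∈V , shift [] (w ++ v) s)
      (semiLetterGraph-arboreal i V w)
      (λ {a} _ → wordGraph-arboreal (source a) (c a) V (a ∷ w))

-- First returns

all-reverse : ∀ {A : Set} {P : Pred A 0ℓ} {w} → All P w → All P (reverse w)
all-reverse [] = []
all-reverse {w = a ∷ w} (p ∷ ps) = subst (All _) (sym (unfold-reverse a w)) (++⁺ (all-reverse ps) (p ∷ []))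

module FirstReturns {A : Set} {Even : Pred A 0ℓ} (even? : Decidable Even) where

  -- Along a path of the parity graph labelled by such a word, the state changes only at the last
  -- letter.
  data Return : List A → Set where
    done : ∀ {a} → ¬ Even a → Return [ a ]
    skip : ∀ {a u} → Even a → Return u → Return (a ∷ u)

  -- Within `S` these are the elements of the even code: a path so labelled is back in its initial
  -- state for the first time at its end.
  data FirstReturn : List A → Set where
    even : ∀ {a} → Even a → FirstReturn [ a ]
    odd  : ∀ {a u} → ¬ Even a → Return u → FirstReturn (a ∷ u)

  skip* : ∀ {e z} → All Even e → Return z → Return (e ++ z)
  skip* []       r = r
  skip* (p ∷ ps) r = skip p (skip* ps r)

  return-shape : ∀ {u} → Return u → ∃[ e ] ∃[ b ] (u ≡ e ++ [ b ] × All Even e × ¬ Even b)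
  return-shape (done o) = [] , _ , refl , [] , o
  return-shape (skip p r) with return-shape r
  ... | e , b , refl , ps , o = _ ∷ e , b , refl , p ∷ ps , o

  -- The shape odd, evens, odd is symmetric. Hence one code serves on both sides, although left
  -- words are reversed.
  firstReturn-reverse : ∀ {u} → FirstReturn u → FirstReturn (reverse u)
  firstReturn-reverse (even p) = even p
  firstReturn-reverse (odd {a} o r) with return-shape r
  ... | e , b , refl , ps , o′ =
    subst FirstReturn (sym (trans (unfold-reverse a (e ++ [ b ])) (cong (_++ [ a ]) (reverse-++ e [ b ]))))
      (odd o′ (skip* (all-reverse ps) (done o)))

  return-prefix : ∀ w → All Even w ⊎ ∃[ z ] ∃[ z′ ] (w ≡ z ++ z′ × Return z)
  return-prefix [] = inj₁ []
  return-prefix (a ∷ w) with even? a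
  ... | no o = inj₂ ([ a ] , w , refl , done o)
  ... | yes p with return-prefix w
  ...   | inj₁ ps = inj₁ (p ∷ ps)
  ...   | inj₂ (z , z′ , refl , r) = inj₂ (a ∷ z , z′ , refl , skip p r)

  return-prefix-++ : ∀ v {a} w → ¬ Even a → ∃[ z ] ∃[ z′ ] (v ++ a ∷ w ≡ z ++ z′ × Return z)
  return-prefix-++ [] w o = _ , w , refl , done o
  return-prefix-++ (b ∷ v) w o with even? b
  ... | no o′ = [ b ] , _ , refl , done o′
  ... | yes p with return-prefix-++ v w o
  ...   | z , z′ , eq , r = b ∷ z , z′ , cong (b ∷_) eq , skip p r

  -- The tree is cut off at depth `n` to be well-founded; the price is that words of `n` even
  -- letters also belong to it.
  returnCode : ℕ → Code A
  returnCode zero    = stop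
  returnCode (suc n) = split λ a → if does (even? a) then returnCode n else stop

  -- For n large enough, the words of S in this code are the first returns; the
  -- other words of the code are those of length n + 1 with an odd letter
  -- followed by even letters only.
  firstReturnCode : ℕ → Code A
  firstReturnCode n = split λ a → if does (even? a) then stop else returnCode n

  returnCode-complete : ∀ {u} n → Return u → length u ≤ n → u ∈ᶜ returnCode n
  returnCode-complete (suc n) (done {a} o) _ with even? a
  ... | yes p = contradiction p o
  ... | no _  = refl
  returnCode-complete (suc n) (skip {a} p r) (s≤s l) with even? a
  ... | yes _ = returnCode-complete n r l
  ... | no o  = contradiction p o

  firstReturnCode-complete : ∀ {u} n → FirstReturn u → length u ≤ n → u ∈ᶜ firstReturnCode n
  firstReturnCode-complete n (even {a} p) _ with even? a
  ... | yes _ = refl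
  ... | no o  = contradiction p o
  firstReturnCode-complete (suc n) (odd {a} o r) (s≤s l) with even? a
  ... | yes p = contradiction p o
  ... | no _  = returnCode-complete (suc n) r (m≤n⇒m≤1+n l)

  returnCode-sound : ∀ n u → u ∈ᶜ returnCode n → Return u ⊎ (All Even u × length u ≡ n)
  returnCode-sound zero    .[]     refl = inj₂ ([] , refl)
  returnCode-sound (suc n) (a ∷ u) m with even? a
  ... | no o with refl ← m = inj₁ (done o)
  ... | yes p with returnCode-sound n u m
  ...   | inj₁ r        = inj₁ (skip p r)
  ...   | inj₂ (ps , l) = inj₂ (p ∷ ps , cong suc l)

  -- A spurious word, an odd letter `a` followed by `n` even letters, recurs in `T`. Reading on from
  -- its first occurrence to the next odd letter gives a first return in `T` longer than `n`. The
  -- set `T` will be `S` or its reversal.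
  firstReturnCode-sound : ∀ {T : Language A} n →
    (∀ u v → T (u ++ v) → T u) → (∀ {u} → T u → ∃[ v ] T (u ++ v ++ u)) →
    (∀ {u} → T u → FirstReturn u → length u ≤ n) →
    ∀ u → T u → u ∈ᶜ firstReturnCode n → FirstReturn u
  firstReturnCode-sound {T} n prefix recur bounded (a ∷ u) t m with even? a
  ... | yes p with refl ← m = even p
  ... | no o with returnCode-sound n u m
  ...   | inj₁ r = odd o r
  ...   | inj₂ (ps , refl) with recur t
  ...     | v , t′ with return-prefix-++ v u o
  ...       | z , z′ , eq , r = contradiction (bounded (prefix (a ∷ u ++ z) z′ t″) (odd o (skip* ps r)))
    (<⇒≱ (s≤s (≤-trans (m≤m+n _ _) (≤-reflexive (sym (length-++ u))))))
    where
    t″ : T (a ∷ (u ++ z) ++ z′)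
    t″ = subst (T ∘ (a ∷_)) (trans (cong (u ++_) eq) (sym (++-assoc u z z′))) t′

  -- For `evenLetter?` this is definitionally the number whose parity `EvenWord` tests.
  count : List A → ℕ
  count w = length (filter (¬? ∘ even?) w)

  count-even : ∀ {a w} → Even a → count (a ∷ w) ≡ count w
  count-even p = cong length (filter-reject (¬? ∘ even?) (λ o → o p))

  count-odd : ∀ {a w} → ¬ Even a → count (a ∷ w) ≡ suc (count w)
  count-odd o = cong length (filter-accept (¬? ∘ even?) o)

  count-evens : ∀ {w} → All Even w → count w ≡ 0
  count-evens []       = refl
  count-evens (p ∷ ps) = trans (count-even p) (count-evens ps)

  count-return : ∀ {w} → Return w → count w ≡ 1
  count-return (done o)   = count-odd o
  count-return (skip p r) = trans (count-even p) (count-return r)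

  count-return-prefix : ∀ u {v} → Return (u ++ v) → v ≢ [] → count u ≡ 0
  count-return-prefix []          _          _    = refl
  count-return-prefix (a ∷ [])    (done _)   v≢[] = contradiction refl v≢[]
  count-return-prefix (a ∷ u)     (skip p r) v≢[] = trans (count-even p) (count-return-prefix u r v≢[])

  count-firstReturn : ∀ {w} → FirstReturn w → 2 ∣ count w
  count-firstReturn (even p)  = subst (2 ∣_) (sym (count-even p)) (2 ∣0)
  count-firstReturn (odd o r) = subst (2 ∣_) (sym (trans (count-odd o) (cong suc (count-return r)))) ∣-refl

2∤1 : ¬ 2 ∣ 1
2∤1 d with ∣⇒≤ d
... | s≤s ()

-- The even code as first returns, and paths of the parity graph.

module Coding {A : Set} {θ : A → A} {S : Language A} (sp : IsSpecular θ S) where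

  open Parity sp
  open ParityGraph sp
  open FirstReturns evenLetter?

  -- By minimality a word starting with an even letter is that letter alone. After an odd first
  -- letter, parity forces a second odd letter, and minimality ends the word there.
  evenCode⇒firstReturn : ∀ {w} → EvenCode w → FirstReturn w
  evenCode⇒firstReturn {[]} x = contradiction refl (EvenCode.nonempty x)
  evenCode⇒firstReturn {a ∷ w} x with evenLetter? a
  evenCode⇒firstReturn {a ∷ []}    x | yes p = even p
  evenCode⇒firstReturn {a ∷ b ∷ w} x | yes p = contradiction
    (letters _ , count-firstReturn (even p))
    (EvenCode.minimal x [ a ] (b ∷ w) refl (λ ()) (λ ()))
  evenCode⇒firstReturn {a ∷ w} x | no o with return-prefix w
  ... | inj₁ ps = contradiction
    (subst (2 ∣_) (trans (count-odd o) (cong suc (count-evens ps))) (proj₂ (EvenCode.even x))) 2∤1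
  ... | inj₂ (z , [] , refl , r) = subst FirstReturn (cong (a ∷_) (sym (++-identityʳ z))) (odd o r)
  ... | inj₂ (z , b ∷ z′ , refl , r) = contradiction
    (prefix-closed (a ∷ z) _ (proj₁ (EvenCode.even x)) , count-firstReturn (odd o r))
    (EvenCode.minimal x (a ∷ z) (b ∷ z′) refl (λ ()) (λ ()))

  firstReturn⇒evenCode : ∀ {w} → S w → FirstReturn w → EvenCode w
  firstReturn⇒evenCode {w} s r = record
    { even     = s , count-firstReturn r
    ; nonempty = nonempty r
    ; minimal  = λ u v eq u≢[] v≢[] (_ , d) → minimal u v (subst FirstReturn eq r) u≢[] v≢[] d
    }
    where
    nonempty : ∀ {w} → FirstReturn w → w ≢ []
    nonempty (even _)  ()
    nonempty (odd _ _) ()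

    minimal : ∀ u v → FirstReturn (u ++ v) → u ≢ [] → v ≢ [] → ¬ 2 ∣ count u
    minimal []       _       _         u≢[] _    _ = u≢[] refl
    minimal (a ∷ []) []      _         _    v≢[] _ = v≢[] refl
    minimal (a ∷ u)  v       (odd o r) _    v≢[] d =
      2∤1 (subst (2 ∣_) (trans (count-odd o) (cong suc (count-return-prefix u r v≢[]))) d)

  even-edge : ∀ {i a j} → EvenLetter a → ParityEdge i a j → i ≡ j
  even-edge (_ , x , y) (y′ , x′) = trans (disjoint y′ y) (disjoint x x′)

  odd-edge : ∀ {i a j} → OddLetter a → ParityEdge i a j → i ≢ j
  odd-edge o (y , x) refl = o (_ , x , y)

  third-state : ∀ {i j k : Fin 2} → i ≢ j → j ≢ k → i ≡ k
  third-state {zero}     {zero}     p q = contradiction refl p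
  third-state {zero}     {suc zero} {zero} p q = refl
  third-state {zero}     {suc zero} {suc zero} p q = contradiction refl q
  third-state {suc zero} {zero} {zero}     p q = contradiction refl q
  third-state {suc zero} {zero} {suc zero} p q = refl
  third-state {suc zero} {suc zero} p q = contradiction refl p

  return-path : ∀ {i w k} → Return w → ParityPath i w k → i ≢ k
  return-path (done o)   (e ∷ [])  = odd-edge o e
  return-path (skip p r) (e ∷ es) with even-edge p e
  ... | refl = return-path r es

  firstReturn-path : ∀ {i w k} → FirstReturn w → ParityPath i w k → i ≡ k
  firstReturn-path (even p)  (e ∷ [])  = even-edge p e
  firstReturn-path (odd o r) (e ∷ es)  = third-state (odd-edge o e) (return-path r es)

  _++ᵖ_ : ∀ {i j k u v} → ParityPath i u j → ParityPath j v k → ParityPath i (u ++ v) k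
  []       ++ᵖ q = q
  (e ∷ p)  ++ᵖ q = e ∷ (p ++ᵖ q)

  path-split : ∀ {i k v} u → ParityPath i (u ++ v) k → ∃[ j ] (ParityPath i u j × ParityPath j v k)
  path-split []      p       = _ , [] , p
  path-split (a ∷ u) (e ∷ p) with path-split u p
  ... | j , q , r = j , e ∷ q , r

  path-starts : ∀ {i w k} → ParityPath i w k → Starts i w
  path-starts []            = tt
  path-starts ((y , _) ∷ _) = source-unique y

  start-unique : ∀ {i j k l w} → w ≢ [] → ParityPath i w k → ParityPath j w l → i ≡ j
  start-unique w≢[] []            _             = contradiction refl w≢[]
  start-unique _    ((y , _) ∷ _) ((y′ , _) ∷ _) = disjoint y y′

  path-ends : ∀ {i k} u → ParityPath i (reverse u) k → Ends k u
  path-ends [] p = tt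
  path-ends (a ∷ u) p with path-split (reverse u) (subst (λ w → ParityPath _ w _) (unfold-reverse a u) p)
  ... | _ , _ , (_ , x) ∷ [] = target-unique x

  path-from : ∀ {i} w → S w → Starts i w → ∃[ k ] ParityPath i w k
  path-from []      _  _    = _ , []
  path-from (a ∷ w) aw refl with path-from w (suffix-closed [ a ] w aw) (starts-after w aw)
  ... | k , p = k , edge a ∷ p

  some-path : ∀ w → S w → ∃[ i ] ∃[ k ] ParityPath i w k
  some-path []      _  = zero , zero , []
  some-path (a ∷ w) aw = source a , path-from (a ∷ w) aw refl

  -- Any path labelled by the whole word is in state `i` at the cut, as the last letter of the left
  -- context fixes that state. If the left context is empty, the path is started at `i`.
  splits⇒paths : ∀ {i} u x → Splits i u x →
    ∃[ h ] ∃[ k ] (ParityPath h (reverse u) i × ParityPath i x k)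
  splits⇒paths {i} [] x (s , _ , t) with path-from x s t
  ... | k , p = i , k , [] , p
  splits⇒paths (a ∷ u) x (s , refl , _) with some-path _ (subst S (ʳ++-defn (a ∷ u)) s)
  ... | h , k , p with path-split (reverse (a ∷ u)) p
  ...   | j , q , r with path-ends (a ∷ u) q
  ...     | refl = h , k , q , r

  paths⇒splits : ∀ {h i k} u x → S (reverse u ++ x) →
    ParityPath h (reverse u) i → ParityPath i x k → Splits i u x
  paths⇒splits u x s p q = subst S (sym (ʳ++-defn u)) s , path-ends u p , path-starts q

-- Decoding

fin-bounded : ∀ {m} (g : Fin m → ℕ) → ∃[ n ] (∀ i → g i ≤ n)
fin-bounded {zero}  g = 0 , λ ()
fin-bounded {suc m} g with fin-bounded (g ∘ suc)
... | n , bound = g zero ⊔ n , λ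
  { zero    → m≤m⊔n (g zero) n
  ; (suc i) → ≤-trans (bound i) (m≤n⊔m (g zero) n) }

finite-bounded : ∀ {B : Set} {m} → B ↔ Fin m → (g : B → ℕ) → ∃[ n ] (∀ b → g b ≤ n)
finite-bounded B↔Fin g with fin-bounded (g ∘ Inverse.from B↔Fin)
... | n , bound = n , λ b →
  ≤-trans (≤-reflexive (cong g (sym (Inverse.strictlyInverseʳ B↔Fin b)))) (bound (Inverse.to B↔Fin b))

tree⇒unionOfTrees : ∀ {V : Set} {G : Graph V} → IsTree G → IsUnionOfTrees 1 G
tree⇒unionOfTrees {G = G} t = record
  { tree            = λ _ → G
  ; isTree          = λ _ → t
  ; isDisjointUnion = record
    { vertex-⇔ = λ _ → mk⇔ (zero ,_) proj₂
    ; adj-⇔    = λ _ _ → mk⇔ (zero ,_) proj₂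
    ; disjoint = λ { {zero} {zero} _ _ → refl }
    }
  }

-- Two uses of recurrence place `w` between two occurrences of a nonempty word.
recurrent⇒biextendable : ∀ {A : Set} {P : Pred A 0ℓ} {S : Language A} → IsRecurrent P S →
  ∃[ w ] (S w × w ≢ []) → IsBiextendable P S
recurrent⇒biextendable {A} {P} {S} rec (x , x∈S , x≢[]) = record
  { isFactorial = isFactorial ; extend = extend }
  where
  open IsRecurrent rec
  open IsFactorial isFactorial

  extend-by : ∀ l w r → l ≢ [] → r ≢ [] → S (l ++ w ++ r) → ∃[ a ] ∃[ b ] B S w a b
  extend-by l w r l≢[] r≢[] s with initLast l | r
  ... | []       | _      = contradiction refl l≢[]
  ... | _ ∷ʳ′ _  | []     = contradiction refl r≢[]
  ... | l′ ∷ʳ′ a | b ∷ r′ = a , b , factors l′ (a ∷ w ++ [ b ]) r′ (subst S eq s)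
    where
    eq : (l′ ++ [ a ]) ++ w ++ b ∷ r′ ≡ l′ ++ (a ∷ w ++ [ b ]) ++ r′
    eq = trans (++-assoc l′ [ a ] (w ++ b ∷ r′)) (cong (λ z → l′ ++ a ∷ z) (sym (++-assoc w [ b ] r′)))

  extend : ∀ {w} → S w → ∃[ a ] ∃[ b ] B S w a b
  extend {w} w∈S with recur w∈S x∈S
  ... | v , _ , wvx with recur x∈S wvx
  ...   | v′ , _ , s = extend-by (x ++ v′) w (v ++ x)
    (x≢[] ∘ ++-conicalˡ x v′) (x≢[] ∘ ++-conicalʳ v x)
    (subst S (sym (++-assoc x v′ (w ++ v ++ x))) s)

module Decoding {A B : Set} {m : ℕ} {θ : A → A} {S : Language A} (_≟_ : DecidableEquality A)
  (B↔Fin : B ↔ Fin m) (sp : IsSpecular θ S) (rec : IsRecurrent U S)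
  {f : List B → List A} (coding : IsCodingMorphism (Parity.EvenCode sp) f) where

  open Parity sp
  open ParityGraph sp
  open FirstReturns evenLetter?
  open Coding sp
  open IsRecurrent rec using (recur)
  open IsCodingMorphism coding

  f-[] : f [] ≡ []
  f-[] = IsMonoidHomomorphism.ε-homo isMorphism

  f-++ : ∀ u v → f (u ++ v) ≡ f u ++ f v
  f-++ = IsMonoidHomomorphism.homo isMorphism

  f-∷-nonempty : ∀ b w → f (b ∷ w) ≢ []
  f-∷-nonempty b w eq =
    Parity.EvenCode.nonempty (into b) (++-conicalˡ (f [ b ]) (f w) (trans (sym (f-++ [ b ] w)) eq))

  letter-firstReturn : ∀ b → FirstReturn (f [ b ])
  letter-firstReturn b = evenCode⇒firstReturn (into b)

  letter∈S : ∀ b → S (f [ b ])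
  letter∈S b = proj₁ (Parity.EvenCode.even (into b))

  loop : ∀ {i k} w → ParityPath i (f w) k → i ≡ k
  loop [] p with f [] | f-[]
  loop [] [] | .[] | refl = refl
  loop (b ∷ w) p with path-split (f [ b ]) (subst (λ x → ParityPath _ x _) (f-++ [ b ] w) p)
  ... | j , q , r = trans (firstReturn-path (letter-firstReturn b) q) (loop w r)

  decode-letter : ∀ {u} → S u → FirstReturn u → ∃[ b ] f [ b ] ≡ u
  decode-letter s r = surjective (firstReturn⇒evenCode s r)

  mutual
    -- A closed path at `i` is cut at its visits to `i`; the pieces are first returns, hence images
    -- of letters.
    decode : ∀ {i} w → S w → ParityPath i w i → ∃[ bs ] f bs ≡ w
    decode [] _ _ = [] , f-[]
    decode (a ∷ w) s (e ∷ p) with evenLetter? a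
    ... | yes a-even with even-edge a-even e
    ...   | refl with decode w (suffix-closed [ a ] w s) p | decode-letter (letters _) (even a-even)
    ...     | bs , refl | b , eq = b ∷ bs , trans (f-++ [ b ] bs) (cong (_++ f bs) eq)
    decode (a ∷ w) s (e ∷ p) | no a-odd
      with decode-return w (suffix-closed [ a ] w s) p (odd-edge a-odd e ∘ sym)
    ... | z , bs , r , refl with decode-letter (prefix-closed (a ∷ z) (f bs) s) (odd a-odd r)
    ...   | b , eq = b ∷ bs , trans (f-++ [ b ] bs) (cong (_++ f bs) eq)

    -- Parses from the other state: `z` completes the first return begun by an odd letter.
    decode-return : ∀ {i j} w → S w → ParityPath j w i → j ≢ i →
      ∃[ z ] ∃[ bs ] (Return z × w ≡ z ++ f bs)
    decode-return [] _ [] j≢j = contradiction refl j≢j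
    decode-return (a ∷ w) s (e ∷ p) j≢i with evenLetter? a
    ... | yes a-even with even-edge a-even e
    ...   | refl with decode-return w (suffix-closed [ a ] w s) p j≢i
    ...     | z , bs , r , refl = a ∷ z , bs , skip a-even r , refl
    decode-return (a ∷ w) s (e ∷ p) j≢i | no a-odd
      with third-state (odd-edge a-odd e ∘ sym) j≢i
    ... | refl with decode w (suffix-closed [ a ] w s) p
    ...   | bs , refl = [ a ] , bs , done a-odd , refl

  maxLength : ℕ
  maxLength = proj₁ (finite-bounded B↔Fin (length ∘ f ∘ [_]))

  firstReturn-bounded : ∀ {u} → S u → FirstReturn u → length u ≤ maxLength
  firstReturn-bounded s r with decode-letter s r
  ... | b , refl = proj₂ (finite-bounded B↔Fin (length ∘ f ∘ [_])) b

  code : Code A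
  code = firstReturnCode maxLength

  letter∈code : ∀ b → f [ b ] ∈ᶜ code
  letter∈code b = firstReturnCode-complete maxLength (letter-firstReturn b)
    (firstReturn-bounded (letter∈S b) (letter-firstReturn b))

  reversed-letter∈code : ∀ b → reverse (f [ b ]) ∈ᶜ code
  reversed-letter∈code b = firstReturnCode-complete maxLength (firstReturn-reverse (letter-firstReturn b))
    (≤-trans (≤-reflexive (length-reverse (f [ b ]))) (firstReturn-bounded (letter∈S b) (letter-firstReturn b)))

  code-letter : ∀ {u} → S u → u ∈ᶜ code → ∃[ b ] f [ b ] ≡ u
  code-letter {u} s m = decode-letter s
    (firstReturnCode-sound maxLength prefix-closed (λ t → map₂ proj₂ (recur t t)) firstReturn-bounded u s m)

  -- The reversals of words of `S` inherit prefix-closure, recurrence and the length bound.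
  reversed-code-letter : ∀ {u} → S (reverse u) → u ∈ᶜ code → ∃[ b ] reverse (f [ b ]) ≡ u
  reversed-code-letter {u} s m with decode-letter s (firstReturn-reverse
      (firstReturnCode-sound {S ∘ reverse} maxLength prefix (λ {u} → recurs u) (λ {u} → bounded u) u s m))
    where
    prefix : ∀ u v → S (reverse (u ++ v)) → S (reverse u)
    prefix u v = suffix-closed (reverse v) (reverse u) ∘ subst S (reverse-++ u v)

    recurs : ∀ u → S (reverse u) → ∃[ v ] S (reverse (u ++ v ++ u))
    recurs u t with recur t t
    ... | v , _ , t′ = reverse v , subst S (sym eq) t′
      where
      eq : reverse (u ++ reverse v ++ u) ≡ reverse u ++ v ++ reverse u
      eq = trans (reverse-++ u (reverse v ++ u)) (trans (cong (_++ reverse u) (reverse-++ (reverse v) u))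
        (trans (++-assoc (reverse u) _ _) (cong (λ z → reverse u ++ z ++ reverse u) (reverse-involutive v))))

    bounded : ∀ u → S (reverse u) → FirstReturn u → length u ≤ maxLength
    bounded u t r = ≤-trans (≤-reflexive (sym (length-reverse u)))
      (firstReturn-bounded t (firstReturn-reverse r))
  ... | b , eq = b , trans (cong reverse eq) (reverse-involutive u)

  -- The two components of the decoding.

  module Component (i : Fin 2) where

    S′ : Language B
    S′ = f ⊢ S[ i , i ]

    alphabet : B → Set
    alphabet = [_] ⊢ f ⊢ (EvenCode ∩ S[ i , i ])

    -- Images under `f` label closed paths only, so the path is in state `i` at the cut too.
    cut : ∀ u v → S′ (u ++ v) → S′ u × S′ v
    cut u v (s , p) with subst S (f-++ u v) s | path-split (f u) (subst (λ x → ParityPath i x i) (f-++ u v) p)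
    ... | uv | j , q , r with loop u q
    ...   | refl = (prefix-closed (f u) (f v) uv , q) , (suffix-closed (f u) (f v) uv , r)

    paste : ∀ u v → S (f u ++ f v) → ParityPath i (f u) i → ParityPath i (f v) i → S′ (u ++ v)
    paste u v s p q = subst S[ i , i ] (sym (f-++ u v)) (s , p ++ᵖ q)

    factorial : IsFactorial alphabet S′
    factorial = record
      { over    = λ {w} → over w
      ; letters = proj₂
      ; factors = λ u v w → proj₁ ∘ cut v w ∘ proj₂ ∘ cut u (v ++ w)
      }
      where
      over : ∀ w → S′ w → All alphabet w
      over []      _ = []
      over (b ∷ w) s with cut [ b ] w s
      ... | s₁ , s₂ = (into b , s₁) ∷ over w s₂

    -- For a letter `b` with source `i`, recurrence gives `b v b` in `S`; then `b v` labels a closed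
    -- path at `i` and can be decoded.
    nonempty-word : ∃[ bs ] (S′ bs × bs ≢ [])
    nonempty-word with some-letter
      where
      some-letter : ∃[ b ] source b ≡ i
      some-letter with IsTree.nonempty (isTree i)
      ... | (b ⊗1) , x = b , source-unique x
      -- If the known vertex of the tree is a left copy of `a`, a letter following `a` has its right
      -- copy in the same tree.
      ... | (1⊗ a) , x with extend (letters {a} _)
      ...   | c , b , s = b , trans (sym (consecutive (suffix-closed [ c ] _ s))) (target-unique x)
    ... | b , refl with recur (letters {b} _) (letters {b} _)
    ...   | v , _ , s with path-from (b ∷ v ++ [ b ]) s refl
    ...     | k , p with path-split (b ∷ v) p
    -- The letter after `b ∷ v` is `b` again, so the path is back in state `source b`.
    ...       | j , q , (y , _) ∷ [] with source-unique y
    ...         | refl with decode (b ∷ v) (prefix-closed (b ∷ v) [ b ] s) q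
    ...           | bs , eq = bs , subst S[ i , i ] (sym eq) (prefix-closed (b ∷ v) [ b ] s , q) , nonempty bs eq
      where
      nonempty : ∀ bs {a w} → f bs ≡ a ∷ w → bs ≢ []
      nonempty .[] eq refl with trans (sym eq) f-[]
      ... | ()

    -- The word that recurrence in `S` inserts runs from `i` to `i`, since its nonempty neighbours
    -- fix the states; hence it decodes.
    recurs : ∀ {u w} → S′ u → S′ w → ∃[ v ] (S′ v × S′ (u ++ v ++ w))
    -- An empty word fixes no state, so these two cases are settled directly.
    recurs {[]}     {w}      s       t       = [] , proj₁ (cut [] w t) , t
    recurs {b ∷ u}  {[]}     s       t       = [] , t , subst S′ (sym (++-identityʳ (b ∷ u))) s
    recurs {b ∷ u}  {c ∷ w}  (s , p) (t , q) with recur s t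
    ... | v , v∈S , svt with some-path _ svt
    ...   | h , _ , r with path-split (f (b ∷ u)) r
    ...     | j , r₁ , r′ with path-split v r′
    ...       | k , r₂ , r₃
      with loop (b ∷ u) r₁ | start-unique (f-∷-nonempty b u) p r₁ | start-unique (f-∷-nonempty c w) q r₃
    ...         | refl | refl | refl with decode v v∈S r₂
    ...           | bs , refl = bs , (v∈S , r₂) ,
      subst S[ i , i ] (sym (trans (f-++ (b ∷ u) (bs ++ c ∷ w)) (cong (f (b ∷ u) ++_) (f-++ bs (c ∷ w)))))
        (svt , p ++ᵖ (r₂ ++ᵖ q))

    recurrent : IsRecurrent alphabet S′
    recurrent = record
      { nontrivial  = λ (⊆[] , _) → proj₂ (proj₂ nonempty-word) (sym (⊆[] (proj₁ (proj₂ nonempty-word))))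
      ; isFactorial = factorial
      ; recur       = recurs
      }

    splits⇒S′ : ∀ u v → Splits i (reverse (f u)) (f v) → S′ (u ++ v)
    splits⇒S′ u v s with splits⇒paths (reverse (f u)) (f v) s
    ... | h , k , p , q with subst (λ x → ParityPath h x i) (reverse-involutive (f u)) p
    ...   | p′ with loop u p′ | loop v q
    ...     | refl | refl = paste u v (subst S eq (proj₁ s)) p′ q
      where
      eq : reverse (f u) ʳ++ f v ≡ f u ++ f v
      eq = trans (ʳ++-defn (reverse (f u))) (cong (_++ f v) (reverse-involutive (f u)))

    S′⇒splits : ∀ u v → S′ (u ++ v) → Splits i (reverse (f u)) (f v)
    S′⇒splits u v s with cut u v s
    ... | (_ , p) , (_ , q) = paths⇒splits (reverse (f u)) (f v)
      (subst S (trans (f-++ u v) (cong (_++ f v) (sym (reverse-involutive (f u))))) (proj₁ s))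
      (subst (λ x → ParityPath i x i) (sym (reverse-involutive (f u))) p) q

    module _ (w : List B) where

      G : Bipartite (List A) (List A)
      G = wordGraph i code code (f w)

      E : Graph (B ⊎ B)
      E = extensionGraph factorial w

      φ : B ⊎ B → List A ⊎ List A
      φ (inj₁ b) = inj₁ (reverse (f [ b ]))
      φ (inj₂ b) = inj₂ (f [ b ])

      φ-injective : ∀ s t → φ s ≡ φ t → s ≡ t
      φ-injective (inj₁ _) (inj₁ _) eq = cong inj₁ (injective (reverse-injective (inj₁-injective eq)))
      φ-injective (inj₂ _) (inj₂ _) eq = cong inj₂ (injective (inj₂-injective eq))

      φ-node : ∀ s → Vertex E s → Node G (φ s)
      φ-node (inj₁ b) s = reversed-letter∈code b , S′⇒splits [ b ] w s
      φ-node (inj₂ b) s = letter∈code b , subst (Splits i []) (f-++ w [ b ])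
        (subst (λ x → Splits i (reverse x) (f (w ++ [ b ]))) f-[] (S′⇒splits [] (w ++ [ b ]) s))

      φ-edge : ∀ {a b} → Defs.B S′ w a b → Edge G (reverse (f [ a ])) (f [ b ])
      φ-edge {a} {b} s = reversed-letter∈code a , letter∈code b ,
        subst (Splits i _) (f-++ w [ b ]) (S′⇒splits [ a ] (w ++ [ b ]) s)

      φ-edge⁻¹ : ∀ {a b} → Edge G (reverse (f [ a ])) (f [ b ]) → Defs.B S′ w a b
      φ-edge⁻¹ {a} {b} (_ , _ , s) =
        splits⇒S′ [ a ] (w ++ [ b ]) (subst (Splits i _) (sym (f-++ w [ b ])) s)

      φ-link : ∀ s t → Adj E s t → Link G (φ s) (φ t)
      φ-link (inj₁ _) (inj₂ _) = φ-edge
      φ-link (inj₂ _) (inj₁ _) = φ-edge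

      -- Spurious words of `code` are not in `S`, so every neighbour of an image is an image; walks
      -- of `G` can thus be pulled back.
      φ-link⁻¹ : ∀ s z → Link G (φ s) z → ∃[ t ] (z ≡ φ t × Adj E s t)
      φ-link⁻¹ (inj₁ a) (inj₂ v) e@(_ , v∈code , s)
        with code-letter (suffix-closed (f w) v (suffix-closedʳ (reverse (f [ a ])) _ (proj₁ s))) v∈code
      ... | b , refl = inj₂ b , refl , φ-edge⁻¹ e
      φ-link⁻¹ (inj₂ b) (inj₁ u) e@(u∈code , _ , s)
        with reversed-code-letter {u} (prefix-closed (reverse u) _ (subst S (ʳ++-defn u) (proj₁ s))) u∈code
      ... | a , refl = inj₁ a , refl , φ-edge⁻¹ e

      φ-path⁻¹ : ∀ {s t z} → Star (Link G) (φ s) z → z ≡ φ t → Star (Adj E) s t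
      φ-path⁻¹ {s} {t} ε eq with φ-injective s t eq
      ... | refl = ε
      φ-path⁻¹ {s} (_◅_ {j = z} e p) eq with φ-link⁻¹ s z e
      ... | _ , refl , e′ = e′ ◅ φ-path⁻¹ p eq

      -- Connectedness is pulled back along `φ`, while a detour would be pushed forward along it.
      extension-tree : ∃ (Vertex E) → IsTree E
      extension-tree nonempty = record
        { nonempty  = nonempty
        ; connected = λ {s} {t} m n → φ-path⁻¹ (connected (φ-node s m) (φ-node t n)) refl
        ; acyclic   = noDetour⇒acyclic E λ {p} {s} {t} e e′ q →
            φ-injective s t (noDetour (φ-link p s e) (φ-link p t e′)
              (gmap φ (λ {x} {y} (d , y≢p) → φ-link x y d , y≢p ∘ φ-injective y p) q))
        }
        where open Arboreal (wordGraph-arboreal _≟_ i code code (f w))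

    treeSet : IsTreeSet 1 alphabet S′
    treeSet = record
      { isBiextendable = biextendable
      ; nonempty-tree  = λ s _ → tree s
      -- Inside one component the empty word is no exception: only `𝒯 i` contributes, so the
      -- characteristic is 1.
      ; empty-forest   = tree⇒unionOfTrees (tree (subst S[ i , i ] (sym f-[]) ([]∈S , [])))
      }
      where
      []∈S : S []
      []∈S = prefix-closed [] _ (proj₁ (proj₁ (proj₂ nonempty-word)))

      biextendable : IsBiextendable alphabet S′
      biextendable = recurrent⇒biextendable recurrent nonempty-word

      tree : ∀ {w} → S′ w → IsTree (extensionGraph factorial w)
      -- `Arboreal` admits the empty graph; biextendability supplies a vertex.
      tree {w} s with IsBiextendable.extend biextendable s
      ... | a , b , awb = extension-tree w (inj₁ a , proj₁ (cut (a ∷ w) [ b ] awb))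

  -- A path labelled by `f w` exists since `f w` is in `S`, and it is closed.
  component-of : ∀ w → S (f w) → ∃[ i ] S[ i , i ] (f w)
  component-of w s with some-path (f w) s
  ... | i , k , p with loop w p
  ...   | refl = i , s , p

theorem4p13 :
    {A B : Set} {n m : ℕ} → A ↔ Fin n → B ↔ Fin m →
    (θ : A → A) (S : Language A) (sp : IsSpecular θ S) → IsRecurrent U S →
    let open Parity sp in
    (f : List B → List A) → IsCodingMorphism EvenCode f →
    let alphabet : Fin 2 → B → Set
        alphabet i = [_] ⊢ f ⊢ (EvenCode ∩ S[ i , i ])
    in
    (∀ i → IsRecurrent (alphabet i) (f ⊢ S[ i , i ]) × IsTreeSet 1 (alphabet i) (f ⊢ S[ i , i ]))
    × (f ⊢ S) ≐ (f ⊢ S[ zero , zero ]) ∪ (f ⊢ S[ suc zero , suc zero ])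
theorem4p13 A↔Fin B↔Fin θ S sp rec f coding =
  (λ i → Component.recurrent i , Component.treeSet i) ,
  ((λ {w} s → case (component-of w s)) , λ { (inj₁ (s , _)) → s ; (inj₂ (s , _)) → s })
  where
  open Parity sp
  open Decoding (inj⇒≟ (↔⇒↣ A↔Fin)) B↔Fin sp rec coding

  case : ∀ {w} → ∃[ i ] S[ i , i ] w → S[ zero , zero ] w ⊎ S[ suc zero , suc zero ] w
  case (zero     , s) = inj₁ s
  case (suc zero , s) = inj₂ s
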